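{- Let $q \ge 2$, $n \ge 1$, $\nu$ and $k$ be integers with $1 \le \nu \le n$ and $0 \le k \le n$. Then $$\sum_{i=1}^{\nu} (q^i-1)\binom{\nu}{i}\binom{n-\nu}{k-i} = \sum_{i=1}^{\nu} (q-1)^i \binom{\nu}{i}\binom{n-i}{k-i}.$$
   Context: Convention: for integers $m \ge 0$ and $j$, $\binom{m}{j}$ is the usual binomial coefficient for $0 \le j \le m$, and $\binom{m}{j} = 0$ if $j < 0$ or $j > m$. -}

module Defs where

open import Data.Integer.Base using (ℤ; +_; -[1+_])
open import Data.List.Base using (applyUpTo)
open import Data.Nat.Base using (ℕ; suc)
open import Data.Nat.Combinatorics using (_C_)
open import Data.Nat.ListAction using (sum)

infix 8 _choose_

-- The lower index is an integer, so that k − i may be negative; the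
-- value is then 0.  For j > m the library's m C j is already 0.
_choose_ : ℕ → ℤ → ℕ
m choose (+ j)    = m C j
m choose -[1+ j ] = 0

-- f 1 + f 2 + … + f m; applyUpTo enumerates 0, …, m − 1.
∑₁ : ℕ → (ℕ → ℕ) → ℕ
∑₁ m f = sum (applyUpTo (λ j → f (suc j)) m)

infix 5 ∑₁

syntax ∑₁ m (λ i → e) = ∑[1≤ i ≤ m ] e

{-# OPTIONS --safe #-}

-- Write U a b = a choose (k − b), so that U (a + 1) b = U a b + U a (b + 1).
-- Let X raise a and Y raise b; on U this says X = 1 + Y, hence
-- X + r Y = 1 + (r + 1) Y.  Expanding the ν-th power of both sides with the
-- binomial theorem, at a = n − ν, b = 0 and with r = q − 1, gives the identity
-- with both sums extended to i = 0 and q ^ i in place of q ^ i − 1.  The case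
-- r = 0 evaluates the difference as n choose k, which is also the term i = 0
-- on the right.
module Submission where

open import Defs
open import Data.Integer.Base using (+_; -[1+_]; _-_; pred)
open import Data.Integer.Properties using (minus-suc)
open import Data.List.Base using (applyUpTo)
open import Data.Nat.Base using (ℕ; zero; suc; _+_; _≤_; _*_; _^_; _∸_)
open import Data.Nat.Combinatorics using (_C_; k>n⇒nCk≡0; nCk+nC[k+1]≡[n+1]C[k+1])
open import Data.Nat.ListAction using (sum)
open import Data.Nat.Properties
open import Data.Nat.Tactic.RingSolver using (solve-∀)
open import Relation.Binary.PropositionalEquality
  using (_≡_; refl; sym; trans; cong; cong₂; module ≡-Reasoning)
open import Algebra.Properties.CommutativeSemigroup +-commutativeSemigroup using (interchange)
open ≡-Reasoning

∑< : ℕ → (ℕ → ℕ) → ℕ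
∑< n f = sum (applyUpTo f n)

infix 5 ∑<

syntax ∑< n (λ i → e) = ∑[ i < n ] e

∑<-cong : ∀ n {f g : ℕ → ℕ} → (∀ i → f i ≡ g i) → ∑< n f ≡ ∑< n g
∑<-cong zero    f≗g = refl
∑<-cong (suc n) f≗g = cong₂ _+_ (f≗g 0) (∑<-cong n (λ i → f≗g (suc i)))

∑<-+ : ∀ n (f g : ℕ → ℕ) → ∑< n (λ i → f i + g i) ≡ ∑< n f + ∑< n g
∑<-+ zero    f g = refl
∑<-+ (suc n) f g =
  trans (cong (_+_ (f 0 + g 0)) (∑<-+ n (λ i → f (suc i)) (λ i → g (suc i))))
        (interchange (f 0) (g 0) _ _)

∑<-*ˡ : ∀ n c (f : ℕ → ℕ) → ∑< n (λ i → c * f i) ≡ c * ∑< n f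
∑<-*ˡ zero    c f = sym (*-zeroʳ c)
∑<-*ˡ (suc n) c f =
  trans (cong (_+_ (c * f 0)) (∑<-*ˡ n c (λ i → f (suc i)))) (sym (*-distribˡ-+ c (f 0) _))

∑<-last : ∀ n (f : ℕ → ℕ) → ∑< (suc n) f ≡ ∑< n f + f n
∑<-last zero    f = +-identityʳ (f 0)
∑<-last (suc n) f =
  trans (cong (_+_ (f 0)) (∑<-last n (λ i → f (suc i)))) (sym (+-assoc (f 0) _ _))

-- Inductive step of the binomial theorem. Pascal's rule splits every weight after the first; one
-- half rejoins the head term, the other is the shifted sum.
∑<-C-suc : ∀ n (f : ℕ → ℕ) →
  (∑[ i < suc (suc n) ] ((suc n C i) * f i)) ≡
  (∑[ i < suc n ] ((n C i) * f i)) + (∑[ i < suc n ] ((n C i) * f (suc i)))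
∑<-C-suc n f = begin
  1 * f 0 + (∑[ i < suc n ] ((suc n C suc i) * f (suc i)))
    ≡⟨ cong (_+_ (1 * f 0)) (∑<-cong (suc n) pascal) ⟩
  1 * f 0 + (∑[ i < suc n ] ((n C suc i) * f (suc i) + (n C i) * f (suc i)))
    ≡⟨ cong (_+_ (1 * f 0)) (∑<-+ (suc n) (λ i → (n C suc i) * f (suc i)) (λ i → (n C i) * f (suc i))) ⟩
  1 * f 0 + ((∑[ i < suc n ] ((n C suc i) * f (suc i))) + shifted)
    ≡⟨ +-assoc (1 * f 0) _ _ ⟨
  (∑[ i < suc (suc n) ] ((n C i) * f i)) + shifted
    ≡⟨ cong (_+ shifted) (∑<-last (suc n) (λ i → (n C i) * f i)) ⟩
  -- Row `n` has been summed one place too far; the surplus term has weight zero.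
  (∑[ i < suc n ] ((n C i) * f i)) + (n C suc n) * f (suc n) + shifted
    ≡⟨ cong (λ z → (∑[ i < suc n ] ((n C i) * f i)) + z * f (suc n) + shifted)
            (k>n⇒nCk≡0 (n<1+n n)) ⟩
  (∑[ i < suc n ] ((n C i) * f i)) + 0 + shifted
    ≡⟨ cong (_+ shifted) (+-identityʳ (∑[ i < suc n ] ((n C i) * f i))) ⟩
  (∑[ i < suc n ] ((n C i) * f i)) + shifted ∎
  where
  shifted = ∑[ i < suc n ] ((n C i) * f (suc i))
  pascal : ∀ i → (suc n C suc i) * f (suc i) ≡ (n C suc i) * f (suc i) + (n C i) * f (suc i)
  pascal i = begin
    (suc n C suc i) * f (suc i)
      ≡⟨ cong (_* f (suc i)) (nCk+nC[k+1]≡[n+1]C[k+1] n i) ⟨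
    (n C i + n C suc i) * f (suc i)
      ≡⟨ cong (_* f (suc i)) (+-comm (n C i) (n C suc i)) ⟩
    (n C suc i + n C i) * f (suc i)
      ≡⟨ *-distribʳ-+ (f (suc i)) (n C suc i) (n C i) ⟩
    (n C suc i) * f (suc i) + (n C i) * f (suc i) ∎

-- (X + c Y) ^ ν applied to h, where X and Y raise the first and second argument.
expand : ℕ → ℕ → (ℕ → ℕ → ℕ) → ℕ → ℕ → ℕ
expand c zero    h a b = h a b
expand c (suc ν) h a b = expand c ν h (suc a) b + c * expand c ν h a (suc b)

-- The shifts X and Y commute, so the ordinary binomial theorem applies: the term with `i` factors
-- `c` Y has `ν ∸ i` factors X.
expand-binomial : ∀ c ν h a b →
  expand c ν h a b ≡ (∑[ i < suc ν ] (c ^ i * (ν C i) * h (a + ν ∸ i) (b + i)))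
expand-binomial c ν h a b =
  trans (go ν a b) (∑<-cong (suc ν) (λ i → swap (ν C i) (c ^ i) (h (a + ν ∸ i) (b + i))))
  where
  swap : ∀ x y z → x * (y * z) ≡ y * x * z
  swap = solve-∀
  go : ∀ ν a b → expand c ν h a b ≡ (∑[ i < suc ν ] ((ν C i) * (c ^ i * h (a + ν ∸ i) (b + i))))
  go zero a b rewrite +-identityʳ a | +-identityʳ b = unit (h a b)
    where
    unit : ∀ x → x ≡ 1 * (1 * x) + 0
    unit = solve-∀
  go (suc ν) a b rewrite +-suc a ν = begin
    expand c ν h (suc a) b + c * expand c ν h a (suc b)
      ≡⟨ cong₂ (λ x y → x + c * y) (go ν (suc a) b) (go ν a (suc b)) ⟩
    (∑[ i < suc ν ] ((ν C i) * f i)) + c * (∑[ i < suc ν ] ((ν C i) * g i))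
      ≡⟨ cong (_+_ (∑[ i < suc ν ] ((ν C i) * f i))) (∑<-*ˡ (suc ν) c (λ i → (ν C i) * g i)) ⟨
    (∑[ i < suc ν ] ((ν C i) * f i)) + (∑[ i < suc ν ] (c * ((ν C i) * g i)))
      ≡⟨ cong (_+_ (∑[ i < suc ν ] ((ν C i) * f i))) (∑<-cong (suc ν) step) ⟩
    (∑[ i < suc ν ] ((ν C i) * f i)) + (∑[ i < suc ν ] ((ν C i) * f (suc i)))
      ≡⟨ ∑<-C-suc ν f ⟨
    (∑[ i < suc (suc ν) ] ((suc ν C i) * f i)) ∎
    where
    f g : ℕ → ℕ
    f i = c ^ i * h (suc (a + ν) ∸ i) (b + i)
    g i = c ^ i * h (a + ν ∸ i) (suc b + i)
    -- One more factor `c` Y turns `g i` into `f (suc i)`; in the latter the two successors around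
    -- `∸` cancel by computation.
    step : ∀ i → c * ((ν C i) * g i) ≡ (ν C i) * f (suc i)
    step i rewrite +-suc b i = assoc c (ν C i) (c ^ i) _
      where
      assoc : ∀ x y z w → x * (y * (z * w)) ≡ y * (x * z * w)
      assoc = solve-∀

Pascal : (ℕ → ℕ → ℕ) → Set
Pascal h = ∀ a b → h (suc a) b ≡ h a b + h a (suc b)

-- The relation X = 1 + Y is linear and invariant under both shifts, so X + `c` Y preserves it.
expand-pascal : ∀ c ν h → Pascal h → Pascal (expand c ν h)
expand-pascal c zero    h p a b = p a b
expand-pascal c (suc ν) h p a b =
  trans (cong₂ (λ x y → x + c * y) (expand-pascal c ν h p (suc a) b)
                                   (expand-pascal c ν h p a (suc b)))
        (regroup c (expand c ν h (suc a) b) (expand c ν h (suc a) (suc b)) _ _)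
  where
  regroup : ∀ c x y z w → x + y + c * (z + w) ≡ (x + c * z) + (y + c * w)
  regroup = solve-∀

-- X + r Y = 1 + (r + 1) Y on Pascal families; on a family that ignores its
-- first argument X acts as 1.
expand-suc : ∀ r ν h → Pascal h → ∀ a a′ b →
  expand r ν h a b ≡ expand (suc r) ν (λ _ → h a) a′ b
expand-suc r zero    h p a a′ b = refl
expand-suc r (suc ν) h p a a′ b = begin
  expand r ν h (suc a) b + r * expand r ν h a (suc b)
    ≡⟨ cong (λ x → x + r * expand r ν h a (suc b)) (expand-pascal r ν h p a b) ⟩
  expand r ν h a b + expand r ν h a (suc b) + r * expand r ν h a (suc b)
    ≡⟨ +-assoc (expand r ν h a b) _ _ ⟩
  expand r ν h a b + suc r * expand r ν h a (suc b)
    ≡⟨ cong₂ (λ x y → x + suc r * y) (expand-suc r ν h p a (suc a′) b)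
                                     (expand-suc r ν h p a a′ (suc b)) ⟩
  expand (suc r) (suc ν) (λ _ → h a) a′ b ∎

-- Without the Y term only the power X ^ `ν` is left.
expand-0 : ∀ ν h a b → expand 0 ν h a b ≡ h (a + ν) b
expand-0 zero    h a b = cong (λ z → h z b) (sym (+-identityʳ a))
expand-0 (suc ν) h a b = begin
  expand 0 ν h (suc a) b + 0 ≡⟨ +-identityʳ _ ⟩
  expand 0 ν h (suc a) b     ≡⟨ expand-0 ν h (suc a) b ⟩
  h (suc a + ν) b            ≡⟨ cong (λ z → h z b) (+-suc a ν) ⟨
  h (a + suc ν) b            ∎

-- The value 0 at negative indices makes Pascal's rule hold for every integer `j`: at `j` = 0 it
-- reads 1 = 1 + 0, below that 0 = 0 + 0.
choose-pascal : ∀ m j → suc m choose j ≡ m choose j + m choose (pred j)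
choose-pascal m (+ zero)  = refl
choose-pascal m (+ suc j) =
  trans (sym (nCk+nC[k+1]≡[n+1]C[k+1] m j)) (+-comm (m C j) (m C suc j))
choose-pascal m -[1+ j ]  = refl

pascal-choose : ∀ k → Pascal (λ a b → a choose (+ k - + b))
pascal-choose k a b =
  trans (choose-pascal a (+ k - + b))
        (cong (λ j → a choose (+ k - + b) + a choose j) (sym (minus-suc (+ k) b)))

-- Two evaluations of `expand r ν h m 0` are compared: directly, where the first argument of `h` is
-- `m + ν ∸ i`, and by `expand-suc`, where it stays `m`.
pascal-identity : ∀ r ν h → Pascal h → ∀ m →
  (∑[1≤ i ≤ ν ] ((suc r ^ i ∸ 1) * (ν C i) * h m i)) ≡
  (∑[1≤ i ≤ ν ] (r ^ i * (ν C i) * h (m + ν ∸ i) i))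
pascal-identity r ν h p m = +-cancelʳ-≡ (h (m + ν) 0) _ _ (begin
  -- Starting at `i` = 0 changes nothing here, as the factor `suc r ^ 0 ∸ 1` computes to 0.
  (∑[ i < suc ν ] ((suc r ^ i ∸ 1) * (ν C i) * h m i)) + h (m + ν) 0
    ≡⟨ cong (_+_ _) (trans (sym (expand-0 ν h m 0)) (expand-const 0)) ⟩
  (∑[ i < suc ν ] ((suc r ^ i ∸ 1) * (ν C i) * h m i)) + (∑[ i < suc ν ] (1 ^ i * (ν C i) * h m i))
    ≡⟨ ∑<-+ (suc ν) (λ i → (suc r ^ i ∸ 1) * (ν C i) * h m i)
            (λ i → 1 ^ i * (ν C i) * h m i) ⟨
  (∑[ i < suc ν ] ((suc r ^ i ∸ 1) * (ν C i) * h m i + 1 ^ i * (ν C i) * h m i))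
    ≡⟨ ∑<-cong (suc ν) split ⟩
  (∑[ i < suc ν ] (suc r ^ i * (ν C i) * h m i))
    ≡⟨ expand-const r ⟨
  expand r ν h m 0
    ≡⟨ expand-binomial r ν h m 0 ⟩
  1 * h (m + ν) 0 + (∑[1≤ i ≤ ν ] (r ^ i * (ν C i) * h (m + ν ∸ i) i))
    ≡⟨ cong (_+ (∑[1≤ i ≤ ν ] (r ^ i * (ν C i) * h (m + ν ∸ i) i))) (*-identityˡ _) ⟩
  h (m + ν) 0 + (∑[1≤ i ≤ ν ] (r ^ i * (ν C i) * h (m + ν ∸ i) i))
    ≡⟨ +-comm (h (m + ν) 0) _ ⟩
  (∑[1≤ i ≤ ν ] (r ^ i * (ν C i) * h (m + ν ∸ i) i)) + h (m + ν) 0 ∎)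
  where
  expand-const : ∀ r → expand r ν h m 0 ≡ (∑[ i < suc ν ] (suc r ^ i * (ν C i) * h m i))
  expand-const r = trans (expand-suc r ν h p m 0 0) (expand-binomial (suc r) ν (λ _ → h m) 0 0)
  split : ∀ i → (suc r ^ i ∸ 1) * (ν C i) * h m i + 1 ^ i * (ν C i) * h m i ≡
                suc r ^ i * (ν C i) * h m i
  split i = begin
    (suc r ^ i ∸ 1) * (ν C i) * h m i + 1 ^ i * (ν C i) * h m i
      ≡⟨ distrib (suc r ^ i ∸ 1) (1 ^ i) (ν C i) (h m i) ⟩
    (suc r ^ i ∸ 1 + 1 ^ i) * (ν C i) * h m i
      ≡⟨ cong (λ z → (suc r ^ i ∸ 1 + z) * (ν C i) * h m i) (^-zeroˡ i) ⟩
    (suc r ^ i ∸ 1 + 1) * (ν C i) * h m i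
      -- The truncated subtraction is exact because powers of `suc r` are positive.
      ≡⟨ cong (λ z → z * (ν C i) * h m i) (m∸n+n≡m (m^n>0 (suc r) i)) ⟩
    suc r ^ i * (ν C i) * h m i ∎
    where
    distrib : ∀ x y z w → x * z * w + y * z * w ≡ (x + y) * z * w
    distrib = solve-∀

mainTheorem4 : ∀ (q n ν k : ℕ) → 2 ≤ q → 1 ≤ n → 1 ≤ ν → ν ≤ n → k ≤ n →
    (∑[1≤ i ≤ ν ] ((q ^ i ∸ 1) * (ν choose (+ i)) * ((n ∸ ν) choose (+ k - + i))))
    ≡ (∑[1≤ i ≤ ν ] ((q ∸ 1) ^ i * (ν choose (+ i)) * ((n ∸ i) choose (+ k - + i))))
mainTheorem4 (suc r) n ν k _ _ _ ν≤n _ =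
  -- Raising the upper index `ν` times from `n ∸ ν` ends at `n`, since `ν ≤ n`.
  trans (pascal-identity r ν (λ a b → a choose (+ k - + b)) (pascal-choose k) (n ∸ ν))
        (cong (λ N → ∑[1≤ i ≤ ν ] (r ^ i * (ν C i) * ((N ∸ i) choose (+ k - + i))))
              (m∸n+n≡m ν≤n))
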